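{- Let $G=K_{s_1,s_2,\dots,s_n}$ be a simple complete multipartite graph with $n$ parts and let $q$ be a prime power with $q\ge n-1$. Then $\operatorname{mr}(\mathbb{F}_q,G)\le 3$.
   Context: $K_{s_1,\dots,s_n}$ is the join of independent sets of sizes $s_1,\dots,s_n$ (every two vertices in different parts adjacent, no edges inside a part). For a field $F$ and a simple graph $G$ on vertices $\{1,\dots,n\}$, $S(F,G)$ is the set of symmetric $n\times n$ matrices $A$ over $F$ with $a_{ij}\neq 0$ for $i\ne j$ iff $ij$ is an edge of $G$ (diagonal entries unrestricted), and $\operatorname{mr}(F,G)=\min\{\operatorname{rank}A: A\in S(F,G)\}$. -}

module Defs where

open import Algebra.Apartness.Bundles using (HeytingField; HeytingCommutativeRing)
open import Algebra.Bundles using (CommutativeRing)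
import Algebra.Properties.Semiring.Sum as SemiringSum
open import Data.Fin.Base using (Fin; zero; suc; splitAt)
open import Data.Nat.Base using (ℕ; _≤_; _^_)
open import Data.Nat.Primality using (Prime)
open import Data.Product.Base using (_×_; ∃; ∃-syntax)
open import Data.Sum.Base using ([_,_]′)
open import Data.Vec.Base using (Vec; []; _∷_; sum)
open import Data.Vec.Functional using (Vector; transpose)
import Data.Vec.Functional.Relation.Binary.Equality.Setoid as VectorEquality
open import Function.Base using (_∘_; const)
open import Function.Bundles using (Inverse; _⇔_)
open import Level using (Level; _⊔_; 0ℓ) renaming (suc to lsuc)
open import Relation.Binary.Core using (Rel)
open import Relation.Binary.Definitions using (Symmetric; Irreflexive)
open import Relation.Binary.PropositionalEquality.Core using (_≡_; _≢_; refl; ≢-sym)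
open import Relation.Binary.PropositionalEquality.Properties using (setoid)
open import Relation.Unary using (Pred; _∈_)

IsPrimePower : ℕ → Set
IsPrimePower q = ∃[ p ] ∃[ k ] (Prime p × 1 ≤ k × q ≡ p ^ k)

record SimpleGraph (n : ℕ) : Set₁ where
  field
    Adj    : Rel (Fin n) 0ℓ
    sym    : Symmetric Adj
    irrefl : Irreflexive _≡_ Adj

-- The parts occupy consecutive blocks of sizes s₁, …, sₙ of the vertex
-- set Fin (s₁ + … + sₙ); `part s v` is the index of the block containing v.
part : ∀ {n} (s : Vec ℕ n) → Fin (sum s) → Fin n
part (s₁ ∷ s) = [ const zero , suc ∘ part s ]′ ∘ splitAt s₁

completeMultipartite : ∀ {n} (s : Vec ℕ n) → SimpleGraph (sum s)
completeMultipartite s = record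
  { Adj    = λ u v → part s u ≢ part s v
  ; sym    = ≢-sym
  ; irrefl = λ { refl u≢u → u≢u refl }
  }

-- A HeytingField may be the zero ring; `HasOrder q` rules this out for q ≥ 2.
module _ {c ℓ₁ ℓ₂ : Level} (F : HeytingField c ℓ₁ ℓ₂) where

  private
    commutativeRing : CommutativeRing c ℓ₁
    commutativeRing =
      HeytingCommutativeRing.commutativeRing (HeytingField.heytingCommutativeRing F)

  open HeytingField F using (Carrier; _≈_; _#_; _*_; 0#)
  open SemiringSum (CommutativeRing.semiring commutativeRing)
    using (sum-syntax)
  open VectorEquality (CommutativeRing.setoid commutativeRing) using (_≋_)

  HasOrder : ℕ → Set (c ⊔ ℓ₁)
  HasOrder q = Inverse (CommutativeRing.setoid commutativeRing) (setoid (Fin q))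

  Matrix : ℕ → ℕ → Set c
  Matrix m n = Vector (Vector Carrier n) m

  linearCombination : ∀ {m r} → Vector Carrier r → Vector (Vector Carrier m) r →
                      Vector Carrier m
  linearCombination {r = r} a v i = ∑[ k < r ] (a k * v k i)

  Span : ∀ {m r} → Vector (Vector Carrier m) r → Pred (Vector Carrier m) (c ⊔ ℓ₁)
  Span v x = ∃[ a ] x ≋ linearCombination a v

  LinearlyIndependent : ∀ {m r} → Vector (Vector Carrier m) r → Set (c ⊔ ℓ₁)
  LinearlyIndependent v =
    ∀ a → linearCombination a v ≋ const 0# → a ≋ const 0#

  record IsBasis {p m r} (v : Vector (Vector Carrier m) r)
                 (W : Pred (Vector Carrier m) p) : Set (c ⊔ ℓ₁ ⊔ p) where
    field
      member      : ∀ k → v k ∈ W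
      independent : LinearlyIndependent v
      spanning    : ∀ x → x ∈ W → x ∈ Span v

  HasDimension : ∀ {p m} → Pred (Vector Carrier m) p → ℕ → Set (c ⊔ ℓ₁ ⊔ p)
  HasDimension {m = m} W r = ∃ λ (v : Vector (Vector Carrier m) r) → IsBasis v W

  ColumnSpace : ∀ {m n} → Matrix m n → Pred (Vector Carrier m) (c ⊔ ℓ₁)
  ColumnSpace A = Span (transpose A)

  HasRank : ∀ {m n} → Matrix m n → ℕ → Set (c ⊔ ℓ₁)
  HasRank A r = HasDimension (ColumnSpace A) r

  -- A ∈ S(F,G); in a HeytingField, x # 0# expresses that x is nonzero.
  record S {n} (G : SimpleGraph n) (A : Matrix n n) : Set (ℓ₁ ⊔ ℓ₂) where
    open SimpleGraph G using (Adj)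
    field
      symmetric : ∀ i j → A i j ≈ A j i
      pattern-G : ∀ i j → i ≢ j → (A i j # 0#) ⇔ Adj i j

  Realizes : ∀ {n} → SimpleGraph n → ℕ → Set (c ⊔ ℓ₁ ⊔ ℓ₂)
  Realizes G r = ∃[ A ] (A ∈ S G × HasRank A r)

  -- `IsMinimumRank G m` says mr(F,G) = m.  A relation rather than a function,
  -- because over a general field the minimum cannot be computed.
  record IsMinimumRank {n} (G : SimpleGraph n) (m : ℕ) : Set (c ⊔ ℓ₁ ⊔ ℓ₂) where
    field
      attained : Realizes G m
      minimal  : ∀ r → Realizes G r → m ≤ r

{-# OPTIONS --safe #-}

-- Assign distinct points of the projective line over F, of which there are
-- q + 1 ≥ n, to the parts, and let the entry at u, v be det(p, p′)² for the
-- points p, p′ of the parts of u, v.  It vanishes exactly inside the parts, and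
-- det² expands as a sum of three products f(u) g(v), so the rank is at most 3 in
-- every characteristic.  Since F is finite, realizability by a given rank is
-- decidable by exhaustive search, so the minimum exists constructively.
module Submission where

open import Defs
open import Algebra.Apartness.Bundles using (HeytingField; HeytingCommutativeRing)
import Algebra.Apartness.Properties.HeytingCommutativeRing as HeytingProperties
open import Algebra.Bundles using (CommutativeRing)
import Algebra.Properties.Ring as RingProperties
import Algebra.Properties.Semiring.Sum as SemiringSum
import Algebra.Solver.Ring.NaturalCoefficients.Default as SemiringSolver
open import Data.Fin.Base using (Fin; zero; suc; combine; funToFin; finToFun; inject≤)
import Data.Fin.Properties as Fin
open import Data.Nat.Base
  using (ℕ; zero; suc; NonZero; _≤_; _<_; _∸_; _^_; z≤n; s≤s; nonTrivial⇒n>1)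
import Data.Nat.Properties as ℕ
open import Data.Nat.Primality using (prime⇒nonTrivial)
open import Data.Product.Base using (_×_; _,_; ∃; ∃-syntax; ∃₂; proj₁; proj₂)
open import Data.Sum.Base using (_⊎_; inj₁; inj₂)
open import Data.Vec.Base using (Vec)
open import Data.Vec.Functional using (Vector; transpose; _∷_; []; head; tail)
import Data.Vec.Functional.Relation.Binary.Equality.Setoid as VectorEquality
open import Data.Vec.Relation.Unary.All using (All)
open import Function.Base using (_∘_; const)
open import Function.Bundles using (Inverse; Injection; Equivalence; mk⇔)
open import Function.Properties.Inverse using (Inverse⇒Injection)
open import Level using (Level)
open import Relation.Binary.Bundles using (Setoid)
open import Relation.Binary.Definitions using (_Respects_)
import Relation.Binary.Definitions as Binary
open import Relation.Binary.PropositionalEquality.Core as ≡ using (_≡_; _≢_)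
open import Relation.Binary.PropositionalEquality.Properties as ≡ using ()
import Relation.Binary.Reasoning.Setoid as ≈-Reasoning
open import Relation.Nullary.Decidable
  using (Dec; yes; no; map′; ¬?; _×-dec_; _→-dec_; via-injection; decidable-stable)
open import Relation.Nullary.Negation using (¬_; contradiction)
open import Relation.Unary using (Pred; Decidable; _∈_; _⊆_)

-- Least witnesses, prime powers and codes of finite functions

private
  variable
    a ℓ p : Level

least : {P : Pred ℕ p} → Decidable P → ∀ n → P n →
        ∃[ m ] (P m × (∀ k → P k → m ≤ k) × m ≤ n)
least P? n Pn with P? zero
least P? n       Pn | yes P0 = zero , P0 , (λ _ _ → z≤n) , z≤n
least P? zero    Pn | no ¬P0 = contradiction Pn ¬P0
least P? (suc n) Pn | no ¬P0 with m , Pm , min , m≤n ← least (P? ∘ suc) n Pn =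
  suc m , Pm , (λ { zero P0 → contradiction P0 ¬P0 ; (suc k) Pk → s≤s (min k Pk) }) , s≤s m≤n

-- Compares `p ^ 0` with `p ^ k`. It makes `q ^ r` strictly increasing in `r`, on which the counting
-- of coefficient vectors rests.
1<primePower : ∀ {q} → IsPrimePower q → 1 < q
1<primePower (p , k , p-prime , 1≤k , ≡.refl) =
  ℕ.^-monoʳ-< p (nonTrivial⇒n>1 p {{prime⇒nonTrivial p-prime}}) 1≤k

funToFin-cong : ∀ {m n} {f g : Fin m → Fin n} → (∀ i → f i ≡ g i) → funToFin f ≡ funToFin g
funToFin-cong {zero}  f≗g = ≡.refl
funToFin-cong {suc m} f≗g = ≡.cong₂ combine (f≗g zero) (funToFin-cong (f≗g ∘ suc))

-- Finite setoids

Finite : Setoid a ℓ → ℕ → Set _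
Finite X n = Inverse X (≡.setoid (Fin n))

module _ {X : Setoid a ℓ} {n} (X↔Fin : Finite X n) where

  open Setoid X
  open Inverse X↔Fin

  finite-≟ : Binary.Decidable _≈_
  finite-≟ = via-injection (Inverse⇒Injection X↔Fin) Fin._≟_

  module _ {P : Pred Carrier p} (resp : P Respects _≈_) (P? : Decidable P) where

    finite-any? : Dec (∃ P)
    finite-any? = map′ (λ (i , Pi) → from i , Pi)
                       -- The search only visits representatives `from i`, and `x` agrees with
                       -- `from (to x)` only up to `_≈_`; `resp` bridges the gap.
                       (λ (x , Px) → to x , resp (sym (strictlyInverseʳ x)) Px)
                       (Fin.any? (P? ∘ from))

    finite-all? : Dec (∀ x → P x)
    finite-all? = map′ (λ ∀P x → resp (strictlyInverseʳ x) (∀P (to x)))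
                       (λ ∀P → ∀P ∘ from)
                       (Fin.all? (P? ∘ from))

  -- A vector is coded by the function `Fin r → Fin n` of the codes of its entries. Applied twice,
  -- this enumerates matrices.
  finite-vector : ∀ r → Finite (VectorEquality.≋-setoid X r) (n ^ r)
  finite-vector r = record
    { to        = λ v → funToFin (to ∘ v)
    ; from      = λ i → from ∘ finToFun i
    ; to-cong   = λ v≋w → funToFin-cong (to-cong ∘ v≋w)
    ; from-cong = λ { ≡.refl _ → refl }
    ; inverse   = (λ {x} {y} y≋ → ≡.trans
                    (funToFin-cong (λ k → inverseˡ (y≋ k)))
                    (Fin.funToFin-finToFin {r} {n} x))
                , (λ { {x} ≡.refl k → trans
                    (from-cong (Fin.finToFun-funToFin (to ∘ x) k))
                    (strictlyInverseʳ (x k)) })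
    }

finite-pigeonhole : ∀ {a ℓ b ℓ′} {X : Setoid a ℓ} {Y : Setoid b ℓ′} {m n} →
  Finite X m → Finite Y n → n < m → (f : Setoid.Carrier X → Setoid.Carrier Y) →
  ∃₂ λ x y → ¬ Setoid._≈_ X x y × Setoid._≈_ Y (f x) (f y)
finite-pigeonhole X↔Fin Y↔Fin n<m f
  with i , j , i<j , eq ← Fin.pigeonhole n<m (Inverse.to Y↔Fin ∘ f ∘ Inverse.from X↔Fin) =
  from i , from j
  , (λ fi≈fj → Fin.<⇒≢ i<j (≡.trans (≡.sym (strictlyInverseˡ i))
                             (≡.trans (to-cong fi≈fj) (strictlyInverseˡ j))))
  , Injection.injective (Inverse⇒Injection Y↔Fin) eq
  where open Inverse X↔Fin

-- Linear algebra over a finite field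

module FiniteField {c ℓ₁ ℓ₂} (F : HeytingField c ℓ₁ ℓ₂) {q} (F↔Fin : HasOrder F q) where

  open HeytingField F hiding (setoid; zero)

  commutativeRing : CommutativeRing c ℓ₁
  commutativeRing = HeytingCommutativeRing.commutativeRing heytingCommutativeRing

  open CommutativeRing commutativeRing using (setoid; semiring; commutativeSemiring; ring)
  open HeytingProperties heytingCommutativeRing
  open RingProperties ring
    using ( -‿distribˡ-*; -‿distribʳ-*; -0#≈0#; -‿involutive; x∙y⁻¹≈ε⇒x≈y; //-rightDividesˡ
          ; +-identityˡ-unique; +-inverseˡ-unique)
  open SemiringSum semiring
  open VectorEquality setoid
  module Rows m = VectorEquality (≋-setoid m)

  -- Decidable equality and apartness

  _≟_ : Binary.Decidable _≈_
  _≟_ = finite-≟ F↔Fin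

  finite-vectors : ∀ m → Finite (≋-setoid m) (q ^ m)
  finite-vectors = finite-vector F↔Fin

  finite-matrices : ∀ m n → Finite (Rows.≋-setoid n m) ((q ^ n) ^ m)
  finite-matrices m n = finite-vector (finite-vectors n) m

  _≋?_ : ∀ {m} → Binary.Decidable (_≋_ {m})
  v ≋? w = Fin.all? λ i → v i ≟ w i

  -- Apartness amounts to invertibility of `x - y`, and an inverse can be searched for in the finite
  -- carrier.
  _#?_ : Binary.Decidable _#_
  x #? y = map′ invertibleˡ⇒# (λ x#y → let (z , z*[x-y]≈1 , _) = #⇒invertible x#y in z , z*[x-y]≈1)
    (finite-any? F↔Fin (λ z≈w → trans (*-congʳ (sym z≈w))) (λ z → (z * (x - y)) ≟ 1#))

  -- Tightness yields only the double negation of `x # y`; decidability removes it.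
  ≉⇒# : ∀ {x y} → ¬ x ≈ y → x # y
  ≉⇒# {x} {y} x≉y = decidable-stable (x #? y) (x≉y ∘ proj₁ (tight x y))

  #⇒≉ : ∀ {x y} → x # y → ¬ x ≈ y
  #⇒≉ {x} {y} x#y x≈y = proj₂ (tight x y) x≈y x#y

  inverse : ∀ {x} → ¬ x ≈ 0# → ∃[ y ] y * x ≈ 1#
  inverse {x} x≉0 with y , y*[x-0]≈1 , _ ← #⇒invertible (≉⇒# x≉0) =
    y , trans (*-congˡ (sym (x-0≈x x))) y*[x-0]≈1

  -- Linear combinations and spans

  private
    lc : ∀ {m r} → Vector Carrier r → Vector (Vector Carrier m) r → Vector Carrier m
    lc = linearCombination F

    variable
      m n r : ℕ

  lc-cong : ∀ {a b : Vector Carrier r} {v w : Vector (Vector Carrier m) r} →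
            a ≋ b → Rows._≋_ m v w → lc a v ≋ lc b w
  lc-cong a≋b v≋w i = sum-cong-≋ λ k → *-cong (a≋b k) (v≋w k i)

  lc-congˡ : ∀ {a : Vector Carrier r} {v w : Vector (Vector Carrier m) r} →
             Rows._≋_ m v w → lc a v ≋ lc a w
  lc-congˡ v≋w = lc-cong ≋-refl v≋w

  lc-congʳ : ∀ {a b : Vector Carrier r} (v : Vector (Vector Carrier m) r) →
             a ≋ b → lc a v ≋ lc b v
  lc-congʳ v a≋b i = sum-cong-≋ λ k → *-congʳ (a≋b k)

  -- Associativity of the matrix product `a b v` with `a` as a row vector, by exchanging the two
  -- sums.
  lc-assoc : ∀ (a : Vector Carrier n) (b : Vector (Vector Carrier r) n)
             (v : Vector (Vector Carrier m) r) →
             lc a (λ j → lc (b j) v) ≋ lc (lc a b) v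
  lc-assoc {n} {r} a b v i = begin
    ∑[ j < n ] (a j * ∑[ k < r ] (b j k * v k i))
      ≈⟨ sum-cong-≋ (λ j → *-distribˡ-sum (a j) λ k → b j k * v k i) ⟩
    ∑[ j < n ] ∑[ k < r ] (a j * (b j k * v k i))
      ≈⟨ ∑-comm (λ j k → a j * (b j k * v k i)) ⟩
    ∑[ k < r ] ∑[ j < n ] (a j * (b j k * v k i))
      ≈⟨ sum-cong-≋ (λ k → sum-cong-≋ λ j → *-assoc (a j) (b j k) (v k i)) ⟨
    ∑[ k < r ] ∑[ j < n ] (a j * b j k * v k i)
      ≈⟨ sum-cong-≋ (λ k → *-distribʳ-sum (v k i) λ j → a j * b j k) ⟨
    ∑[ k < r ] (∑[ j < n ] (a j * b j k) * v k i) ∎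
    where open ≈-Reasoning setoid

  lc-scale : ∀ x (a : Vector Carrier r) (v : Vector (Vector Carrier m) r) i →
             x * lc a v i ≈ lc (λ k → x * a k) v i
  lc-scale x a v i = trans (*-distribˡ-sum x λ k → a k * v k i)
                           (sum-cong-≋ λ k → sym (*-assoc x (a k) (v k i)))

  lc-difference : ∀ {a b : Vector Carrier r} (v : Vector (Vector Carrier m) r) →
                  lc a v ≋ lc b v → lc (λ k → a k - b k) v ≋ const 0#
  lc-difference {r} {a = a} {b} v av≋bv i = +-identityˡ-unique _ (lc b v i) (begin
    lc (λ k → a k - b k) v i + lc b v i
      ≈⟨ ∑-distrib-+ (λ k → (a k - b k) * v k i) (λ k → b k * v k i) ⟨
    ∑[ k < r ] ((a k - b k) * v k i + b k * v k i)
      ≈⟨ sum-cong-≋ (λ k → distribʳ (v k i) (a k - b k) (b k)) ⟨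
    ∑[ k < r ] ((a k - b k + b k) * v k i)
      ≈⟨ sum-cong-≋ (λ k → *-congʳ (//-rightDividesˡ (b k) (a k))) ⟩
    lc a v i ≈⟨ av≋bv i ⟩
    lc b v i ∎)
    where open ≈-Reasoning setoid

  Span-resp : (v : Vector (Vector Carrier m) r) → Span F v Respects _≋_
  Span-resp v x≋y (a , x≋av) = a , ≋-trans (≋-sym x≋y) x≋av

  Span-cong : ∀ {v w : Vector (Vector Carrier m) r} → Rows._≋_ m v w → Span F v ⊆ Span F w
  Span-cong v≋w (a , x≋av) = a , ≋-trans x≋av (lc-congˡ v≋w)

  Span-mono : ∀ {v : Vector (Vector Carrier m) n} {w : Vector (Vector Carrier m) r} →
              (∀ k → v k ∈ Span F w) → Span F v ⊆ Span F w
  Span-mono {w = w} v∈ (a , x≋av) =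
    lc a (proj₁ ∘ v∈) , ≋-trans x≋av (≋-trans (lc-congˡ (proj₂ ∘ v∈)) (lc-assoc a (proj₁ ∘ v∈) w))

  span? : (v : Vector (Vector Carrier m) r) → Decidable (Span F v)
  span? v x = finite-any? (finite-vectors _)
    (λ a≋b x≋av → ≋-trans x≋av (lc-congʳ v a≋b)) (λ a → x ≋? lc a v)

  -- Linear independence

  Dependent : Vector (Vector Carrier m) r → Set _
  Dependent v = ∃[ a ] (lc a v ≋ const 0# × ¬ a ≋ const 0#)

  -- There are finitely many coefficient vectors, so failure of independence produces an explicit
  -- nontrivial relation.
  independent-or-dependent : (v : Vector (Vector Carrier m) r) →
                             LinearlyIndependent F v ⊎ Dependent v
  independent-or-dependent v
    with finite-any? (finite-vectors _)
           (λ a≋b (av≋0 , a≉0) → ≋-trans (lc-congʳ v (≋-sym a≋b)) av≋0 , a≉0 ∘ ≋-trans a≋b)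
           (λ a → (lc a v ≋? const 0#) ×-dec ¬? (a ≋? const 0#))
  ... | yes dep = inj₂ dep
  ... | no ¬dep = inj₁ λ a av≋0 →
    decidable-stable (a ≋? const 0#) λ a≉0 → ¬dep (a , av≋0 , a≉0)

  independent? : (v : Vector (Vector Carrier m) r) → Dec (LinearlyIndependent F v)
  independent? v with independent-or-dependent v
  ... | inj₁ ind = yes ind
  ... | inj₂ (a , av≋0 , a≉0) = no λ ind → a≉0 (ind a av≋0)

  independent-cong : ∀ {v w : Vector (Vector Carrier m) r} → Rows._≋_ m v w →
                     LinearlyIndependent F v → LinearlyIndependent F w
  independent-cong v≋w ind a aw≋0 = ind a (≋-trans (lc-congˡ v≋w) aw≋0)

  independent-unique : {v : Vector (Vector Carrier m) r} → LinearlyIndependent F v →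
                       ∀ {a b} → lc a v ≋ lc b v → a ≋ b
  independent-unique {v = v} ind {a} {b} av≋bv k =
    x∙y⁻¹≈ε⇒x≈y (a k) (b k) (ind (λ k → a k - b k) (lc-difference v av≋bv) k)

  -- With more than r vectors there are more coefficient vectors a than elements of Fʳ.
  independent-size : 1 < q → {v : Vector (Vector Carrier m) n} {w : Vector (Vector Carrier m) r} →
                     LinearlyIndependent F v → (∀ k → v k ∈ Span F w) → n ≤ r
  independent-size {n = n} {r} 1<q {v} {w} ind v∈ = ℕ.≮⇒≥ λ r<n →
    let (a , b , a≉b , ac≋bc) = finite-pigeonhole (finite-vectors n) (finite-vectors r)
                                  (ℕ.^-monoʳ-< q 1<q r<n) (λ a → lc a coords)
    in a≉b (independent-unique ind
         (≋-trans (expand a) (≋-trans (lc-congʳ w ac≋bc) (≋-sym (expand b)))))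
    where
    coords = proj₁ ∘ v∈
    expand : ∀ a → lc a v ≋ lc (lc a coords) w
    expand a = ≋-trans (lc-congˡ (proj₂ ∘ v∈)) (lc-assoc a coords w)

  -- If the coefficient of `x` vanished, the rest would be a nontrivial relation among `v`; so it is
  -- invertible, and dividing by it solves for `x`.
  dependent⇒∈Span : {v : Vector (Vector Carrier m) r} → LinearlyIndependent F v →
                    ∀ {x} → Dependent (x ∷ v) → x ∈ Span F v
  dependent⇒∈Span {v = v} ind {x} (a , lc≋0 , a≉0) with head a ≟ 0#
  ... | yes a₀≈0 = contradiction a≋0 a≉0
    where
    tail≋0 : lc (tail a) v ≋ const 0#
    tail≋0 i = trans (sym (trans (+-congʳ (trans (*-congʳ a₀≈0) (zeroˡ (x i)))) (+-identityˡ _)))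
                     (lc≋0 i)
    a≋0 : a ≋ const 0#
    a≋0 zero    = a₀≈0
    a≋0 (suc k) = ind (tail a) tail≋0 k
  ... | no a₀≉0 with b , ba₀≈1 ← inverse a₀≉0 = (λ k → (- b) * tail a k) , λ i → begin
    x i                              ≈⟨ *-identityˡ (x i) ⟨
    1# * x i                         ≈⟨ *-congʳ ba₀≈1 ⟨
    b * head a * x i                 ≈⟨ *-assoc b (head a) (x i) ⟩
    b * (head a * x i)               ≈⟨ *-congˡ (+-inverseˡ-unique _ _ (lc≋0 i)) ⟩
    b * (- lc (tail a) v i)          ≈⟨ -‿distribʳ-* b _ ⟨
    - (b * lc (tail a) v i)          ≈⟨ -‿distribˡ-* b _ ⟩
    (- b) * lc (tail a) v i          ≈⟨ lc-scale (- b) (tail a) v i ⟩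
    lc (λ k → (- b) * tail a k) v i  ∎
    where open ≈-Reasoning setoid

  -- Bases, dimension and rank

  module _ {W : Pred (Vector Carrier m) p} (W-resp : W Respects _≋_) (W? : Decidable W) where

    basis? : (v : Vector (Vector Carrier m) r) → Dec (IsBasis F v W)
    basis? v = map′
      (λ (v∈ , ind , span) → record { member = v∈ ; independent = ind ; spanning = span })
      (λ B → let open IsBasis B in member , independent , spanning)
      (Fin.all? (W? ∘ v) ×-dec independent? v ×-dec
       finite-all? (finite-vectors m)
         (λ x≋y x∈ y∈ → Span-resp v x≋y (x∈ (W-resp (≋-sym x≋y) y∈)))
         (λ x → W? x →-dec span? v x))

    hasDimension? : ∀ r → Dec (HasDimension F W r)
    hasDimension? r = finite-any? (finite-matrices r m)
      (λ v≋w B → let open IsBasis B in record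
        { member      = λ k → W-resp (v≋w k) (member k)
        ; independent = independent-cong v≋w independent
        ; spanning    = λ x x∈ → Span-cong v≋w (spanning x x∈)
        })
      basis?

    -- Descends from `r` to the first size at which `W` contains an independent family. No family
    -- one larger is independent, so this one spans `W`.
    independent-bound⇒dimension≤ : ∀ r →
      (∀ (v : Vector (Vector Carrier m) (suc r)) → (∀ k → v k ∈ W) → ¬ LinearlyIndependent F v) →
      ∃[ d ] (HasDimension F W d × d ≤ r)
    independent-bound⇒dimension≤ r bound
      with finite-any? (finite-matrices r m)
             (λ v≋w (v∈ , ind) → (λ k → W-resp (v≋w k) (v∈ k)) , independent-cong v≋w ind)
             (λ v → Fin.all? (W? ∘ v) ×-dec independent? v)
    ... | yes (v , v∈ , ind) = r , (v , record
          { member = v∈ ; independent = ind ; spanning = spanning }) , ℕ.≤-refl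
      where
      spanning : ∀ x → x ∈ W → x ∈ Span F v
      spanning x x∈ with independent-or-dependent (x ∷ v)
      ... | inj₁ ind′ = contradiction ind′ (bound (x ∷ v) λ { zero → x∈ ; (suc k) → v∈ k })
      ... | inj₂ dep  = dependent⇒∈Span ind dep
    -- The empty family is independent, so the search cannot fail at size zero.
    independent-bound⇒dimension≤ zero    bound | no none =
      contradiction ([] , (λ ()) , λ _ _ ()) none
    independent-bound⇒dimension≤ (suc r) bound | no none
      -- The failed search at size `suc r` is exactly the bound needed for `r`.
      with d , dim , d≤r ← independent-bound⇒dimension≤ r (λ v v∈ ind → none (v , v∈ , ind)) =
      d , dim , ℕ.m≤n⇒m≤1+n d≤r

  hasDimension-cong : ∀ {W W′ : Pred (Vector Carrier m) p} → W ⊆ W′ → W′ ⊆ W →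
                      HasDimension F W r → HasDimension F W′ r
  hasDimension-cong W⊆W′ W′⊆W (v , B) = let open IsBasis B in v , record
    { member      = W⊆W′ ∘ member
    ; independent = independent
    ; spanning    = λ x x∈ → spanning x (W′⊆W x∈)
    }

  hasRank? : ∀ (A : Matrix F m n) r → Dec (HasRank F A r)
  hasRank? A = hasDimension? (Span-resp (transpose A)) (span? (transpose A))

  hasRank-resp : ∀ {A B : Matrix F m n} → Rows._≋_ n A B → HasRank F A r → HasRank F B r
  hasRank-resp A≋B = hasDimension-cong (Span-cong λ j i → A≋B i j) (Span-cong λ j i → sym (A≋B i j))

  -- Independent families in the column space lie in the span of `w`, so they have at most `r`
  -- members.
  rank≤ : 1 < q → (A : Matrix F m n) (w : Vector (Vector Carrier m) r) →
          (∀ j → transpose A j ∈ Span F w) → ∃[ d ] (HasRank F A d × d ≤ r)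
  rank≤ {r = r} 1<q A w cols∈ =
    independent-bound⇒dimension≤ (Span-resp (transpose A)) (span? (transpose A)) r
      λ v v∈ ind → ℕ.1+n≰n (independent-size 1<q ind (Span-mono cols∈ ∘ v∈))

  -- Minimum rank by exhaustive search

  module _ (G : SimpleGraph n) (Adj? : Binary.Decidable (SimpleGraph.Adj G)) where

    S-resp : S F G Respects Rows._≋_ n
    S-resp A≋B A∈ = record
      { symmetric = λ i j → trans (sym (A≋B i j)) (trans (symmetric i j) (A≋B j i))
      ; pattern-G = λ i j i≢j → let open Equivalence (pattern-G i j i≢j) in
          mk⇔ (to ∘ #-congʳ (sym (A≋B i j))) (#-congʳ (A≋B i j) ∘ from)
      }
      where open S A∈

    S? : Decidable (S F G)
    S? A = map′
      (λ (sm , pat) → record { symmetric = sm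
        ; pattern-G = λ i j i≢j → mk⇔ (proj₁ (pat i j i≢j)) (proj₂ (pat i j i≢j)) })
      (λ A∈ → let open S A∈ in symmetric , λ i j i≢j →
        let open Equivalence (pattern-G i j i≢j) in to , from)
      ((Fin.all? λ i → Fin.all? λ j → A i j ≟ A j i) ×-dec
       (Fin.all? λ i → Fin.all? λ j → ¬? (i Fin.≟ j) →-dec
         (((A i j #? 0#) →-dec Adj? i j) ×-dec (Adj? i j →-dec (A i j #? 0#)))))

    realizes? : ∀ r → Dec (Realizes F G r)
    realizes? r = finite-any? (finite-matrices n n)
      (λ A≋B (A∈ , rank) → S-resp A≋B A∈ , hasRank-resp A≋B rank)
      (λ A → S? A ×-dec hasRank? A r)

    minimumRank≤ : Realizes F G r → ∃[ m ] (IsMinimumRank F G m × m ≤ r)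
    minimumRank≤ {r} realizes with m , attained , minimal , m≤r ← least realizes? r realizes =
      m , record { attained = attained ; minimal = minimal } , m≤r

  -- The projective line

  Point : Set c
  Point = Carrier × Carrier

  -- The determinant x y′ - y x′, with the sign inside so that expanding its
  -- square is an identity of commutative semirings.
  det : Point → Point → Carrier
  det (x , y) (x′ , y′) = x * y′ + y * (- x′)

  det-antisym : ∀ P Q → det P Q ≈ - det Q P
  det-antisym (x , y) (x′ , y′) = +-inverseˡ-unique _ _ (begin
    x * y′ + y * (- x′) + (x′ * y + y′ * (- x))
      -- `m` and `m′` stand for `- x` and `- x′`, which the semiring solver treats as atoms;
      -- regrouping exposes the cancelling sums.
      ≈⟨ solve 6 (λ x y x′ y′ m m′ → x :* y′ :+ y :* m′ :+ (x′ :* y :+ y′ :* m) :=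
                                     (x :+ m) :* y′ :+ (x′ :+ m′) :* y)
               refl x y x′ y′ (- x) (- x′) ⟩
    (x - x) * y′ + (x′ - x′) * y
      ≈⟨ +-cong (*-congʳ (-‿inverseʳ x)) (*-congʳ (-‿inverseʳ x′)) ⟩
    0# * y′ + 0# * y
      ≈⟨ +-cong (zeroˡ y′) (zeroˡ y) ⟩
    0# + 0#
      ≈⟨ +-identityˡ 0# ⟩
    0# ∎)
    where
    open ≈-Reasoning setoid
    open SemiringSolver commutativeSemiring

  det-diagonal : ∀ P → det P P ≈ 0#
  det-diagonal (x , y) = trans (+-cong (*-comm x y) (sym (-‿distribʳ-* y x))) (-‿inverseʳ (y * x))

  det² : Point → Point → Carrier
  det² P Q = det P Q * det P Q

  det²-comm : ∀ P Q → det² P Q ≈ det² Q P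
  det²-comm P Q = begin
    det P Q * det P Q          ≈⟨ *-cong (det-antisym P Q) (det-antisym P Q) ⟩
    (- det Q P) * (- det Q P)  ≈⟨ -‿distribˡ-* _ _ ⟨
    - (det Q P * (- det Q P))  ≈⟨ -‿cong (-‿distribʳ-* _ _) ⟨
    - - (det Q P * det Q P)    ≈⟨ -‿involutive _ ⟩
    det Q P * det Q P          ∎
    where open ≈-Reasoning setoid

  -- The monomials spanning the binary quadratic forms, evaluated at the points: the coordinates of
  -- the degree-two Veronese map.
  quadratics : (Fin m → Point) → Vector (Vector Carrier m) 3
  quadratics P zero             i = let (x , y) = P i in x * x
  quadratics P (suc zero)       i = let (x , y) = P i in x * y
  quadratics P (suc (suc zero)) i = let (x , y) = P i in y * y

  det²-∈Span : ∀ (P : Fin m → Point) Q → (λ i → det² (P i) Q) ∈ Span F (quadratics P)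
  det²-∈Span P (x′ , y′) =
    -- For fixed `Q` the squared determinant is a quadratic form in `x` and `y`, with these
    -- coefficients. The middle one is a doubled term, which is zero in characteristic 2.
    (y′ * y′ ∷ y′ * (- x′) + y′ * (- x′) ∷ (- x′) * (- x′) ∷ []) , λ i →
      solve 4 (λ x y y′ m → (x :* y′ :+ y :* m) :* (x :* y′ :+ y :* m) :=
                y′ :* y′ :* (x :* x) :+ ((y′ :* m :+ y′ :* m) :* (x :* y) :+
                -- `con 0` is the empty tail of the sum over `Fin 3`.
                (m :* m :* (y :* y) :+ con 0)))
            refl (proj₁ (P i)) (proj₂ (P i)) y′ (- x′)
    where open SemiringSolver commutativeSemiring

  -- Index zero receives the point at infinity; the other `n ∸ 1` indices receive distinct affine
  -- points, one for each field element used.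
  point : n ∸ 1 ≤ q → Fin n → Point
  point n-1≤q zero    = 1# , 0#
  point n-1≤q (suc i) = Inverse.from F↔Fin (inject≤ i n-1≤q) , 1#

  -- The determinant of the point at infinity with an affine point is 1 up to sign, and that of two
  -- affine points is the difference of their coordinates.
  det-point≉0 : ∀ (n-1≤q : n ∸ 1 ≤ q) {i j : Fin n} → i ≢ j →
                ¬ det (point {n} n-1≤q i) (point n-1≤q j) ≈ 0#
  det-point≉0 n-1≤q {zero}  {zero}  i≢j _ = i≢j ≡.refl
  det-point≉0 n-1≤q {zero}  {suc j} i≢j det≈0 = #⇒≉ 1#0 (trans (sym det≈1) det≈0)
    where
    det≈1 : det (point n-1≤q zero) (point n-1≤q (suc j)) ≈ 1#
    det≈1 = trans (+-cong (*-identityʳ 1#) (zeroˡ _)) (+-identityʳ 1#)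
  det-point≉0 n-1≤q {suc i} {zero}  i≢j det≈0 =
    det-point≉0 n-1≤q {zero} {suc i} (λ ()) (trans (det-antisym _ _) (trans (-‿cong det≈0) -0#≈0#))
  det-point≉0 n-1≤q {suc i} {suc j} i≢j det≈0 = i≢j (≡.cong suc (Fin.inject≤-injective _ _ i j
    (≡.trans (≡.sym (strictlyInverseˡ _)) (≡.trans (to-cong x≈x′) (strictlyInverseˡ _)))))
    where
    open Inverse F↔Fin
    x≈x′ : from (inject≤ i n-1≤q) ≈ from (inject≤ j n-1≤q)
    x≈x′ = x∙y⁻¹≈ε⇒x≈y _ _
      (trans (+-cong (sym (*-identityʳ _)) (sym (*-identityˡ _))) det≈0)

  -- A matrix of rank at most 3 for the multipartite graph

  multipartite-realizes≤3 : 1 < q → n ∸ 1 ≤ q → (s : Vec ℕ n) →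
    ∃[ r ] (Realizes F (completeMultipartite s) r × r ≤ 3)
  multipartite-realizes≤3 {n} 1<q n-1≤q s =
    let (r , rank , r≤3) = rank≤ 1<q A (quadratics pt) columns∈Span in r , (A , A∈S , rank) , r≤3
    where
    pt : Fin _ → Point
    pt = point {n} n-1≤q ∘ part s
    -- Squaring makes the antisymmetric determinant symmetric and keeps its zero pattern.
    A : Matrix F _ _
    A u v = det² (pt u) (pt v)
    columns∈Span : ∀ v → transpose A v ∈ Span F (quadratics pt)
    columns∈Span v = det²-∈Span pt (pt v)
    A∈S : A ∈ S F (completeMultipartite s)
    A∈S = record
      { symmetric = λ u v → det²-comm (pt u) (pt v)
      ; pattern-G = λ u v _ → mk⇔
          (λ det²#0 same → #⇒≉ det²#0 (vanishes u v same))
          (λ differ → let d#0 = ≉⇒# (det-point≉0 {n} n-1≤q differ) in x#0y#0→xy#0 d#0 d#0)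
      }
      where
      vanishes : ∀ u v → part s u ≡ part s v → A u v ≈ 0#
      vanishes u v same rewrite same = trans (*-congʳ (det-diagonal (pt v))) (zeroˡ _)

mainTheorem18 : ∀ {c ℓ₁ ℓ₂} (n : ℕ) (s : Vec ℕ n) → All NonZero s →
    (q : ℕ) → IsPrimePower q → n ∸ 1 ≤ q →
    (F : HeytingField c ℓ₁ ℓ₂) → HasOrder F q →
    ∃[ m ] (IsMinimumRank F (completeMultipartite s) m × m ≤ 3)
mainTheorem18 n s _ q q-primePower n-1≤q F F↔Fin =
  let open FiniteField F F↔Fin
      r , realizes , r≤3 = multipartite-realizes≤3 (1<primePower q-primePower) n-1≤q s
      m , isMin , m≤r = minimumRank≤ (completeMultipartite s)
                          -- Adjacency is inequality of part indices in `Fin n`, hence decidable, as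
                          -- the exhaustive search requires.
                          (λ u v → ¬? (part s u Fin.≟ part s v)) realizes
  in m , isMin , ℕ.≤-trans m≤r r≤3
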